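{- Let $m\ge 2$, $s\ge 1$ and let $X_1,\dots,X_m\in\mathbb{Z}^s$ (not necessarily distinct) span $\mathbb{R}^s$ and satisfy $\langle X_j,\alpha\rangle>0$ for all $j$, for some $\alpha\in\mathbb{R}^s$. Let $\mathcal{J}=X_1\mathbb{N}+\dots+X_m\mathbb{N}$, $\mathcal{L}=X_1\mathbb{Z}+\dots+X_m\mathbb{Z}$ and $\mathbf{C}_X=X_1\mathbb{R}^++\dots+X_m\mathbb{R}^+$. Then the Frobenius set $$\mathcal{F}=\{g\in\mathcal{J}:\ g+\mathbf{C}_X \text{ is a maximal saturated cone}\}$$ is non-empty and finite.
   Context: $\mathbb{N}=\{0,1,2,\dots\}$, $\mathbb{R}^+=[0,\infty)$. For $g\in\mathcal{J}$, the cone $g+\mathbf{C}_X$ is called saturated if $(g+\mathbf{C}_X)\cap\mathcal{J}=(g+\mathbf{C}_X)\cap\mathcal{L}$, i.e. every point of $\mathcal{L}$ in $g+\mathbf{C}_X$ lies in $\mathcal{J}$. A saturated cone $g+\mathbf{C}_X$ is maximal if it is not contained in any other saturated cone $g'+\mathbf{C}_X$ ($g'\in\mathcal{J}$).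
   Formalization: The real numbers are replaced by the rationals: α is a rational vector, the X_j are assumed to span ℚ^s, and the cone C_X is formed with non-negative rational coefficients, with containment of cones tested on rational points. -}

module Defs where

open import Data.Nat using (ℕ; zero; suc)
open import Data.Fin using (Fin; zero; suc)
open import Data.Integer as ℤ using (ℤ)
open import Data.Rational as ℚ using (ℚ; 0ℚ)
open import Data.Product using (Σ; ∃; _×_; _,_)
open import Data.List using (List)
open import Data.List.Membership.Propositional using (_∈_)
open import Relation.Binary.PropositionalEquality using (_≡_; _≢_)
open import Relation.Nullary using (¬_)

sumℚ : {n : ℕ} → (Fin n → ℚ) → ℚ
sumℚ {zero}  f = 0ℚ
sumℚ {suc n} f = f zero ℚ.+ sumℚ (λ i → f (suc i))

sumℤ : {n : ℕ} → (Fin n → ℤ) → ℤ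
sumℤ {zero}  f = ℤ.+ 0
sumℤ {suc n} f = f zero ℤ.+ sumℤ (λ i → f (suc i))

toℚ : ℤ → ℚ
toℚ z = z ℚ./ 1

Vℤ : ℕ → Set
Vℤ s = Fin s → ℤ

Vℚ : ℕ → Set
Vℚ s = Fin s → ℚ

module _ {m s : ℕ} (X : Fin m → Vℤ s) where

  Spans : Set
  Spans = (v : Vℚ s) → ∃ λ (μ : Fin m → ℚ) →
            (i : Fin s) → v i ≡ sumℚ (λ j → μ j ℚ.* toℚ (X j i))

  PositiveFunctional : Set
  PositiveFunctional = ∃ λ (α : Vℚ s) →
    (j : Fin m) → 0ℚ ℚ.< sumℚ (λ i → toℚ (X j i) ℚ.* α i)

  InJ : Vℤ s → Set
  InJ g = ∃ λ (c : Fin m → ℕ) →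
    (i : Fin s) → g i ≡ sumℤ (λ j → ℤ.+ (c j) ℤ.* X j i)

  InL : Vℤ s → Set
  InL g = ∃ λ (c : Fin m → ℤ) →
    (i : Fin s) → g i ≡ sumℤ (λ j → c j ℤ.* X j i)

  InCone : Vℤ s → Vℚ s → Set
  InCone g y = ∃ λ (λ' : Fin m → ℚ) →
    ((j : Fin m) → 0ℚ ℚ.≤ λ' j) ×
    ((i : Fin s) → y i ≡ toℚ (g i) ℚ.+ sumℚ (λ j → λ' j ℚ.* toℚ (X j i)))

  -- g + C_X is saturated: (g + C_X) ∩ 𝒥 = (g + C_X) ∩ ℒ
  -- (the inclusion ⊆ is automatic since 𝒥 ⊆ ℒ; we state the nontrivial one)
  Saturated : Vℤ s → Set
  Saturated g = (h : Vℤ s) → InL h → InCone g (λ i → toℚ (h i)) → InJ h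

  ConeSubset : Vℤ s → Vℤ s → Set
  ConeSubset g g' = (y : Vℚ s) → InCone g y → InCone g' y

  ConeDiffer : Vℤ s → Vℤ s → Set
  ConeDiffer g g' = ¬ ((y : Vℚ s) → (InCone g y → InCone g' y) × (InCone g' y → InCone g y))

  MaximalSaturated : Vℤ s → Set
  MaximalSaturated g =
    InJ g × Saturated g ×
    ((g' : Vℤ s) → InJ g' → Saturated g' → ConeSubset g g' → ¬ ConeDiffer g g')

  InFrobenius : Vℤ s → Set
  InFrobenius = MaximalSaturated

FiniteSet : {s : ℕ} → (Vℤ s → Set) → Set
FiniteSet {s} P = ∃ λ (L : List (Vℤ s)) →
  (g : Vℤ s) → P g → ∃ λ (g' : Vℤ s) → g' ∈ L × ((i : Fin s) → g i ≡ g' i)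

{-# OPTIONS --safe #-}
module Submission where

-- For c ∈ ℕᵐ write Xc = Σ cⱼXⱼ.  Clearing denominators and dividing with remainder shows that Xc
-- is saturated iff Xc + r ∈ 𝒥 for each of the finitely many r ∈ ℒ ∩ C_X in a fixed box.  The set of
-- c with Xc + r ∈ 𝒥 is upward closed and generated by finitely many explicit elements, read off
-- from a Hilbert basis of the homogenised system X d − X c = t r; joins of generators then
-- generate the intersection over r, which is non-empty because every r lies in ℒ.  So there is a
-- finite list K of coefficient vectors such that every saturated g ∈ 𝒥 lies in Xk + C_X for some
-- k ∈ K.  A maximal g is one of the Xk because C_X is pointed, and an Xk with ⟨Xk, α⟩ smallest is
-- maximal.  Hilbert bases, unlike a bare appeal to Dickson's lemma, keep all of this constructive.

open import Defs
open import Data.Nat as ℕ using (ℕ; zero; suc; _≤_; z≤n; s≤s; _⊔_)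
import Data.Nat.Properties as ℕ
import Data.Nat.DivMod as ℕ
open import Data.Nat.Induction using (<-wellFounded)
open import Data.Fin using (Fin; zero; suc; splitAt; _↑ˡ_; _↑ʳ_)
import Data.Fin.Properties as Fin
open import Data.Integer as ℤ using (ℤ; +_; -[1+_]; 0ℤ; ∣_∣; -_; _+_; _*_; _-_; +≤+)
import Data.Integer.Properties as ℤ
open import Data.Integer.Tactic.RingSolver using (solve-∀)
open import Data.List using (List; []; _∷_; _++_; map; cartesianProductWith; filter; upTo; allFin;
  length; lookup)
open import Data.List.Extrema ℤ.≤-totalOrder using (argmin; argmin-sel; f[argmin]≤f[xs])
open import Data.List.Membership.Propositional using (_∈_)
open import Data.List.Membership.Propositional.Properties
  using (∈-map⁺; ∈-map⁻; ∈-++⁺ˡ; ∈-++⁺ʳ; ∈-filter⁺; ∈-filter⁻; ∈-lookup; ∈-upTo⁺; ∈-allFin;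
         ∈-cartesianProductWith⁺; ∈-cartesianProductWith⁻)
import Data.List.Relation.Unary.All as All
open import Data.List.Relation.Unary.Any using (here; there; index)
open import Data.List.Relation.Unary.Any.Properties using (lookup-index; ¬Any[])
open import Data.Product using (∃; _×_; _,_; proj₁; proj₂)
open import Data.Rational as ℚ using (ℚ; mkℚ; 0ℚ; 1ℚ; toℚᵘ; fromℚᵘ)
import Data.Rational.Properties as ℚ
open import Data.Rational.Unnormalised as ℚᵘ using (mkℚᵘ; *≡*; *≤*; *<*)
import Data.Rational.Unnormalised.Properties as ℚᵘ
open import Data.Sum using (inj₁; inj₂; [_,_]′)
open import Function using (_∘_)
open import Induction.WellFounded using (Acc; acc)
open import Relation.Binary.PropositionalEquality
open import Relation.Nullary using (¬_; Dec; yes; no; contradiction)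
open import Relation.Nullary.Decidable using (_×-dec_; decidable-stable)

private variable
  m n p s : ℕ

-- Finite sums of integers and of natural numbers.

sumℤ-cong : {f g : Fin n → ℤ} → f ≗ g → sumℤ f ≡ sumℤ g
sumℤ-cong {zero}  e = refl
sumℤ-cong {suc n} e = cong₂ _+_ (e zero) (sumℤ-cong (e ∘ suc))

sumℤ-zero : {f : Fin n → ℤ} → (∀ i → f i ≡ 0ℤ) → sumℤ f ≡ 0ℤ
sumℤ-zero {zero}  e = refl
sumℤ-zero {suc n} e = cong₂ _+_ (e zero) (sumℤ-zero (e ∘ suc))

sumℤ-+ : (f g : Fin n → ℤ) → sumℤ (λ i → f i + g i) ≡ sumℤ f + sumℤ g
sumℤ-+ {zero}  f g = refl
sumℤ-+ {suc n} f g rewrite sumℤ-+ (f ∘ suc) (g ∘ suc) = interchange (f zero) (g zero) (sumℤ (f ∘ suc)) (sumℤ (g ∘ suc))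
  where
  interchange : ∀ a b c d → (a + b) + (c + d) ≡ (a + c) + (b + d)
  interchange = solve-∀

sumℤ-* : (c : ℤ) (f : Fin n → ℤ) → sumℤ (λ i → c * f i) ≡ c * sumℤ f
sumℤ-* {zero}  c f = sym (ℤ.*-zeroʳ c)
sumℤ-* {suc n} c f rewrite sumℤ-* c (f ∘ suc) = sym (ℤ.*-distribˡ-+ c _ _)

sumℤ-neg : (f : Fin n → ℤ) → sumℤ (λ i → - f i) ≡ - sumℤ f
sumℤ-neg {zero}  f = refl
sumℤ-neg {suc n} f rewrite sumℤ-neg (f ∘ suc) = sym (ℤ.neg-distrib-+ (f zero) _)

sumℤ-nonneg : {f : Fin n → ℤ} → (∀ i → 0ℤ ℤ.≤ f i) → 0ℤ ℤ.≤ sumℤ f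
sumℤ-nonneg {zero}  e = ℤ.≤-refl
sumℤ-nonneg {suc n} e = ℤ.+-mono-≤ (e zero) (sumℤ-nonneg (e ∘ suc))

term≤sumℤ : {f : Fin n → ℤ} → (∀ i → 0ℤ ℤ.≤ f i) → ∀ i → f i ℤ.≤ sumℤ f
term≤sumℤ {f = f} e zero =
  subst (ℤ._≤ sumℤ f) (ℤ.+-identityʳ _) (ℤ.+-monoʳ-≤ (f zero) (sumℤ-nonneg (e ∘ suc)))
term≤sumℤ {f = f} e (suc i) =
  subst (ℤ._≤ sumℤ f) (ℤ.+-identityˡ _) (ℤ.+-mono-≤ (e zero) (term≤sumℤ (e ∘ suc) i))

sumℕ : (Fin n → ℕ) → ℕ
sumℕ {zero}  f = 0
sumℕ {suc n} f = f zero ℕ.+ sumℕ (f ∘ suc)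

pos-sumℕ : (f : Fin n → ℕ) → + sumℕ f ≡ sumℤ (λ i → + f i)
pos-sumℕ {zero}  f = refl
pos-sumℕ {suc n} f = cong (λ z → + f zero + z) (pos-sumℕ (f ∘ suc))

term≤sumℕ : (f : Fin n → ℕ) → ∀ i → f i ≤ sumℕ f
term≤sumℕ f zero    = ℕ.m≤m+n _ _
term≤sumℕ f (suc i) = ℕ.≤-trans (term≤sumℕ (f ∘ suc) i) (ℕ.m≤n+m _ _)

sumℕ-cong : {f g : Fin n → ℕ} → f ≗ g → sumℕ f ≡ sumℕ g
sumℕ-cong {zero}  e = refl
sumℕ-cong {suc n} e = cong₂ ℕ._+_ (e zero) (sumℕ-cong (e ∘ suc))

sumℕ-mono : {f g : Fin n → ℕ} → (∀ i → f i ≤ g i) → sumℕ f ≤ sumℕ g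
sumℕ-mono {zero}  e = z≤n
sumℕ-mono {suc n} e = ℕ.+-mono-≤ (e zero) (sumℕ-mono (e ∘ suc))

sumℕ-+ : (f g : Fin n → ℕ) → sumℕ (λ i → f i ℕ.+ g i) ≡ sumℕ f ℕ.+ sumℕ g
sumℕ-+ f g = ℤ.+-injective (trans (pos-sumℕ (λ i → f i ℕ.+ g i))
  (trans (sumℤ-+ (λ i → + f i) (λ i → + g i)) (sym (cong₂ _+_ (pos-sumℕ f) (pos-sumℕ g)))))

-- Pairing of natural coefficient vectors with integer vectors.

infix 8 _·_
_·_ : (Fin n → ℕ) → (Fin n → ℤ) → ℤ
x · a = sumℤ (λ i → + x i * a i)

·-congˡ : {x y : Fin n → ℕ} {a : Fin n → ℤ} → x ≗ y → x · a ≡ y · a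
·-congˡ {a = a} e = sumℤ-cong (λ i → cong (λ z → + z * a i) (e i))

·-congʳ : {x : Fin n → ℕ} {a b : Fin n → ℤ} → a ≗ b → x · a ≡ x · b
·-congʳ {x = x} e = sumℤ-cong (λ i → cong (+ x i *_) (e i))

·-+ : (x y : Fin n → ℕ) (a : Fin n → ℤ) → (λ i → x i ℕ.+ y i) · a ≡ x · a + y · a
·-+ x y a = trans (sumℤ-cong (λ i → ℤ.*-distribʳ-+ (a i) (+ x i) (+ y i)))
                  (sumℤ-+ (λ i → + x i * a i) (λ i → + y i * a i))

·-* : (c : ℕ) (x : Fin n → ℕ) (a : Fin n → ℤ) → (λ i → c ℕ.* x i) · a ≡ + c * x · a
·-* c x a = trans (sumℤ-cong (λ i → trans (cong (_* a i) (ℤ.pos-* c (x i)))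
                                          (ℤ.*-assoc (+ c) (+ x i) (a i))))
                  (sumℤ-* (+ c) (λ i → + x i * a i))

·-neg : (x : Fin n → ℕ) (a : Fin n → ℤ) → x · (λ i → - a i) ≡ - (x · a)
·-neg x a = trans (sumℤ-cong (λ i → sym (ℤ.neg-distribʳ-* (+ x i) (a i))))
                  (sumℤ-neg (λ i → + x i * a i))

-- Exchange of two finite sums, that is, associativity of row times matrix times column. It carries
-- linear equations through a change of generators.
·-assoc : (y : Fin p → ℕ) (H : Fin p → Fin n → ℤ) (a : Fin n → ℤ) →
  sumℤ (λ i → y · (λ k → H k i) * a i) ≡ y · (λ k → sumℤ (λ i → H k i * a i))
·-assoc {zero}  y H a = sumℤ-zero (λ i → ℤ.*-zeroˡ (a i))
·-assoc {suc p} y H a = begin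
  sumℤ (λ i → (+ y zero * H zero i + (y ∘ suc) · (λ k → H (suc k) i)) * a i)
    ≡⟨ sumℤ-cong (λ i → expand (+ y zero) (H zero i) _ (a i)) ⟩
  sumℤ (λ i → + y zero * (H zero i * a i) + (y ∘ suc) · (λ k → H (suc k) i) * a i)
    ≡⟨ sumℤ-+ (λ i → + y zero * (H zero i * a i)) _ ⟩
  sumℤ (λ i → + y zero * (H zero i * a i)) + sumℤ (λ i → (y ∘ suc) · (λ k → H (suc k) i) * a i)
    ≡⟨ cong₂ _+_ (sumℤ-* (+ y zero) (λ i → H zero i * a i)) (·-assoc (y ∘ suc) (H ∘ suc) a) ⟩
  y · (λ k → sumℤ (λ i → H k i * a i)) ∎
  where
  open ≡-Reasoning
  expand : ∀ c h r b → (c * h + r) * b ≡ c * (h * b) + r * b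
  expand = solve-∀

δ : Fin n → Fin n → ℕ
δ zero    zero    = 1
δ zero    (suc j) = 0
δ (suc i) zero    = 0
δ (suc i) (suc j) = δ i j

δ-refl : (i : Fin n) → δ i i ≡ 1
δ-refl zero    = refl
δ-refl (suc i) = δ-refl i

δ-≢ : {i j : Fin n} → i ≢ j → δ i j ≡ 0
δ-≢ {i = zero}  {zero}  ne = contradiction refl ne
δ-≢ {i = zero}  {suc j} ne = refl
δ-≢ {i = suc i} {zero}  ne = refl
δ-≢ {i = suc i} {suc j} ne = δ-≢ (ne ∘ cong suc)

δ-sym : (i j : Fin n) → δ i j ≡ δ j i
δ-sym zero    zero    = refl
δ-sym zero    (suc j) = refl
δ-sym (suc i) zero    = refl
δ-sym (suc i) (suc j) = δ-sym i j

δ-· : (i : Fin n) (a : Fin n → ℤ) → δ i · a ≡ a i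
δ-· zero a = trans (cong₂ _+_ (ℤ.*-identityˡ (a zero)) (sumℤ-zero (λ i → ℤ.*-zeroˡ (a (suc i)))))
                   (ℤ.+-identityʳ (a zero))
δ-· (suc i) a = trans (cong₂ _+_ (ℤ.*-zeroˡ (a zero)) (δ-· i (a ∘ suc))) (ℤ.+-identityˡ _)

-- Enumeration of vectors with entries from a list.

tuples : {A : Set} → (n : ℕ) → List A → List (Fin n → A)
tuples zero    L = (λ ()) ∷ []
tuples {A} (suc n) L = cartesianProductWith cons L (tuples n L)
  module Tuples where
  cons : A → (Fin n → A) → Fin (suc n) → A
  cons a v zero    = a
  cons a v (suc i) = v i

-- Functions on `Fin n` are compared pointwise, without function extensionality, so the listed `w`
-- agrees with `v` only up to `≗`.
tuples-complete : {A : Set} (L : List A) (v : Fin n → A) → (∀ i → v i ∈ L) →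
  ∃ λ w → w ∈ tuples n L × v ≗ w
tuples-complete {zero} L v h = (λ ()) , here refl , λ ()
tuples-complete {suc n} L v h with tuples-complete L (v ∘ suc) (h ∘ suc)
... | w , w∈ , e = _ , ∈-cartesianProductWith⁺ (Tuples.cons n L) (h zero) w∈
                     , λ { zero → refl ; (suc i) → e i }

-- Hilbert bases of homogeneous linear systems

Kernel : (Fin s → Fin n → ℤ) → (Fin n → ℕ) → Set
Kernel A x = ∀ r → x · A r ≡ 0ℤ

-- Generation is all that is asked: the vectors may repeat, be zero or be redundant. `complete` is
-- stated over the integers so that the laws of `_·_` apply.
record HilbertBasis (A : Fin s → Fin n → ℤ) : Set where
  field
    size     : ℕ
    vec      : Fin size → Fin n → ℕ
    sound    : ∀ k → Kernel A (vec k)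
    complete : ∀ x → Kernel A x → ∃ λ (y : Fin size → ℕ) → ∀ i → + x i ≡ y · (λ k → + vec k i)

module _ (a : Fin n → ℤ) (B : ℕ) (a≤B : ∀ i → ∣ a i ∣ ≤ B) where

  -- The inner sum, `n` times `B * B`, bounds the negative terms when every negative coefficient
  -- sits at an entry below `B`. The summand `B` leaves room for `part-pair`, the successor for a
  -- unit vector even if `B` is 0.
  bound : ℕ
  bound = suc (B ℕ.+ sumℕ {n} (λ _ → B ℕ.* B))

  -- A bounded nonzero solution below `x`; subtracting it drives the induction in `hilbertBasis₁`.
  record Part (x : Fin n → ℕ) : Set where
    field
      part     : Fin n → ℕ
      part≤    : ∀ i → part i ≤ x i
      small    : ∀ i → part i ≤ bound
      nonzero  : ∃ λ i → 1 ≤ part i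
      solution : part · a ≡ 0ℤ

  B≤bound : B ≤ bound
  B≤bound = ℕ.≤-trans (ℕ.m≤m+n B _) (ℕ.n≤1+n _)

  part-zero : ∀ x i → a i ≡ 0ℤ → bound ℕ.< x i → Part x
  part-zero x i ai≡0 big = record
    { part = δ i ; part≤ = le (ℕ.≤-trans (s≤s z≤n) big) ; small = λ j → δ≤1 i j
    ; nonzero = i , ℕ.≤-reflexive (sym (δ-refl i))
    ; solution = trans (δ-· i a) ai≡0 }
    where
    δ≤1 : ∀ {n} (i j : Fin n) {b} → δ i j ≤ suc b
    δ≤1 zero    zero    = s≤s z≤n
    δ≤1 zero    (suc j) = z≤n
    δ≤1 (suc i) zero    = z≤n
    δ≤1 (suc i) (suc j) = δ≤1 i j
    le : ∀ {n} {i : Fin n} {x : Fin n → ℕ} → 1 ≤ x i → ∀ j → δ i j ≤ x j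
    le {i = zero}  p zero    = p
    le {i = zero}  p (suc j) = z≤n
    le {i = suc i} p zero    = z≤n
    le {i = suc i} {x} p (suc j) = le {i = i} {x ∘ suc} p j

  -- Two coefficients of opposite sign cancel with swapped weights: `v + 1` copies of the unit
  -- vector at `i` and `u + 1` of the one at `j`. Both weights are absolute values of coefficients,
  -- hence at most `B`.
  part-pair : ∀ x i j {u v} → a i ≡ + suc u → a j ≡ -[1+ v ] → B ≤ x i → B ≤ x j → Part x
  part-pair x i j {u} {v} ei ej Bi Bj = record
    { part = w ; part≤ = λ k → proj₁ (w≤ k) ; small = λ k → proj₂ (w≤ k)
    ; nonzero = i , ℕ.≤-trans (s≤s z≤n) (ℕ.≤-reflexive (sym wi)) ; solution = sol }
    where
    i≢j : i ≢ j
    i≢j refl with trans (sym ei) ej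
    ... | ()
    w : Fin n → ℕ
    w k = suc v ℕ.* δ i k ℕ.+ suc u ℕ.* δ j k
    wi : w i ≡ suc v
    wi rewrite δ-refl i | δ-≢ (i≢j ∘ sym) | ℕ.*-zeroʳ u | ℕ.*-identityʳ v = ℕ.+-identityʳ _
    wj : w j ≡ suc u
    wj rewrite δ-refl j | δ-≢ i≢j | ℕ.*-zeroʳ v | ℕ.*-identityʳ u = refl
    w-other : ∀ {k} → i ≢ k → j ≢ k → w k ≡ 0
    w-other i≢k j≢k rewrite δ-≢ i≢k | δ-≢ j≢k | ℕ.*-zeroʳ u | ℕ.*-zeroʳ v = refl
    u<B : suc u ≤ B
    u<B = subst (_≤ B) (cong ∣_∣ ei) (a≤B i)
    v<B : suc v ≤ B
    v<B = subst (_≤ B) (cong ∣_∣ ej) (a≤B j)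
    w≤ : ∀ k → w k ≤ x k × w k ≤ bound
    w≤ k with i Fin.≟ k | j Fin.≟ k
    ... | yes refl | _        rewrite wi = ℕ.≤-trans v<B Bi , ℕ.≤-trans v<B B≤bound
    ... | no _     | yes refl rewrite wj = ℕ.≤-trans u<B Bj , ℕ.≤-trans u<B B≤bound
    ... | no p     | no q     rewrite w-other p q = z≤n , z≤n
    cancel : ∀ a b → b * a + a * (- b) ≡ 0ℤ
    cancel = solve-∀
    sol : w · a ≡ 0ℤ
    sol = begin
      w · a
        ≡⟨ ·-+ (λ k → suc v ℕ.* δ i k) (λ k → suc u ℕ.* δ j k) a ⟩
      (λ k → suc v ℕ.* δ i k) · a + (λ k → suc u ℕ.* δ j k) · a
        ≡⟨ cong₂ _+_ (·-* (suc v) (δ i) a) (·-* (suc u) (δ j) a) ⟩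
      + suc v * δ i · a + + suc u * δ j · a      ≡⟨ cong₂ (λ y z → + suc v * y + + suc u * z)
                                                      (trans (δ-· i a) ei) (trans (δ-· j a) ej) ⟩
      + suc v * + suc u + + suc u * -[1+ v ]     ≡⟨ cancel (+ suc u) (+ suc v) ⟩
      0ℤ                                         ∎
      where open ≡-Reasoning

  -- If no negative coefficient had a large coordinate, the term of i alone would outweigh all
  -- the negative terms.
  part-pos : ∀ x i {u} → a i ≡ + suc u → x · a ≡ 0ℤ → bound ℕ.< x i → Part x
  part-pos x i {u} ei sol big with Fin.any? (λ j → (a j ℤ.<? 0ℤ) ×-dec (B ℕ.≤? x j))
  ... | yes (j , aj<0 , Bj) with a j in ej
  ...   | + _      = contradiction aj<0 λ { (ℤ.+<+ ()) }
  ...   | -[1+ v ] = part-pair x i j ei ej (ℕ.≤-trans B≤bound (ℕ.<⇒≤ big)) Bj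
  part-pos x i {u} ei sol big | no none = contradiction big (ℕ.≤⇒≯ xi≤)
    where
    M = B ℕ.* B
    -- By `none`, a negative coefficient comes with `x j` at most `B`, so adding `M` makes its term
    -- non-negative too.
    shifted : ∀ j → 0ℤ ℤ.≤ + x j * a j + + M
    shifted j with a j | a≤B j | (λ lt Bj → none (j , lt , Bj))
    ... | + c      | _ | _ = ℤ.+-mono-≤ (subst (0ℤ ℤ.≤_) (ℤ.pos-* (x j) c) (+≤+ z≤n)) (+≤+ z≤n)
    ... | -[1+ c ] | c<B | h = subst (λ z → 0ℤ ℤ.≤ z + + M) eq
          (subst (0ℤ ℤ.≤_) (ℤ.+-comm (+ M) (- (+ (x j ℕ.* suc c)))) (ℤ.i≤j⇒0≤j-i (+≤+ (ℕ.*-mono-≤ (ℕ.≰⇒≥ (h ℤ.-<+)) c<B))))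
      where
      eq : - (+ (x j ℕ.* suc c)) ≡ + x j * -[1+ c ]
      eq = trans (cong -_ (ℤ.pos-* (x j) (suc c))) (ℤ.neg-distribʳ-* (+ x j) (+ suc c))
    step : + x i * + suc u + + M ℤ.≤ + sumℕ {n} (λ _ → M)
    step = subst₂ ℤ._≤_ (cong (λ z → + x i * z + + M) ei)
      (trans (sumℤ-+ (λ j → + x j * a j) (λ _ → + M))
             (trans (cong (_+ sumℤ {n} (λ _ → + M)) sol) (trans (ℤ.+-identityˡ _) (sym (pos-sumℕ {n} (λ _ → M))))))
      (term≤sumℤ shifted i)
    xi≤ : x i ≤ bound
    xi≤ = begin
      x i                          ≤⟨ ℕ.m≤m*n (x i) (suc u) ⟩
      x i ℕ.* suc u                ≤⟨ ℕ.m≤m+n _ M ⟩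
      x i ℕ.* suc u ℕ.+ M
        ≤⟨ ℤ.drop‿+≤+ (subst (λ z → z + + M ℤ.≤ + sumℕ {n} (λ _ → M)) (sym (ℤ.pos-* (x i) (suc u))) step) ⟩
      sumℕ {n} (λ _ → M)           ≤⟨ ℕ.m≤n+m _ B ⟩
      B ℕ.+ sumℕ {n} (λ _ → M)     ≤⟨ ℕ.n≤1+n _ ⟩
      bound                        ∎
      where open ℕ.≤-Reasoning

part-of : (a : Fin n → ℤ) (B : ℕ) (a≤B : ∀ i → ∣ a i ∣ ≤ B) → ∀ x i → x · a ≡ 0ℤ →
  bound a B a≤B ℕ.< x i → Part a B a≤B x
part-of a B a≤B x i sol big with a i in ei
... | + zero   = part-zero a B a≤B x i ei big
... | + suc u  = part-pos a B a≤B x i ei sol big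
-- Negating `a` exchanges the signs and keeps the solutions; `bound` depends only on `n` and `B`, so
-- it does not change.
... | -[1+ u ] = record
  { part = part ; part≤ = part≤ ; small = small ; nonzero = nonzero
  ; solution = ℤ.neg-injective (trans (sym (·-neg part a)) solution) }
  where
  open Part (part-pos (λ j → - a j) B (λ j → subst (_≤ B) (sym (ℤ.∣-i∣≡∣i∣ (a j))) (a≤B j)) x i
    (cong -_ ei) (trans (·-neg x a) (cong -_ sol)) big)

-- The solutions with entries at most `N` generate: a solution with a larger entry contains a
-- nonzero solution from that box, and what remains has a smaller sum of entries.
hilbertBasis₁ : (A : Fin 1 → Fin n → ℤ) → HilbertBasis A
hilbertBasis₁ {n} A = record
  { size = length basis ; vec = lookup basis
  ; sound = λ { k zero → proj₂ (∈-filter⁻ solution? {xs = box} (∈-lookup k)) }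
  ; complete = λ x h → generate x (<-wellFounded (sumℕ x)) (h zero) }
  where
  a = A zero
  B = sumℕ (λ i → ∣ a i ∣)
  a≤B = term≤sumℕ (λ i → ∣ a i ∣)
  N = bound a B a≤B
  box = tuples n (upTo (suc N))
  solution? = λ x → x · a ℤ.≟ 0ℤ
  basis = filter solution? box
  in-basis : ∀ x → x · a ≡ 0ℤ → (∀ i → x i ≤ N) → ∃ λ k → x ≗ lookup basis k
  in-basis x sol small with tuples-complete (upTo (suc N)) x (λ i → ∈-upTo⁺ (s≤s (small i)))
  ... | w , w∈ , e = index w∈basis , λ i → trans (e i) (cong (λ v → v i) (lookup-index w∈basis))
    where w∈basis = ∈-filter⁺ solution? w∈ (trans (·-congˡ {a = a} (sym ∘ e)) sol)
  generate : ∀ x → Acc ℕ._<_ (sumℕ x) → x · a ≡ 0ℤ → ∃ λ y → ∀ i → + x i ≡ y · (λ k → + lookup basis k i)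
  generate x (acc rec) sol with Fin.any? (λ i → N ℕ.<? x i)
  ... | no none with in-basis x sol (λ i → ℕ.≮⇒≥ (λ lt → none (i , lt)))
  ...   | k , e = δ k , λ i → trans (cong +_ (e i)) (sym (δ-· k (λ l → + lookup basis l i)))
  generate x (acc rec) sol | yes (i , big) with part-of a B a≤B x i sol big
  ... | record { part = v ; part≤ = v≤x ; small = small ; nonzero = l , vl ; solution = vsol }
    with in-basis v vsol small | generate rest (rec smaller) restsol
    where
    rest : Fin n → ℕ
    rest j = x j ℕ.∸ v j
    split : ∀ j → v j ℕ.+ rest j ≡ x j
    split j = ℕ.m+[n∸m]≡n (v≤x j)
    smaller : sumℕ rest ℕ.< sumℕ x
    smaller = ℕ.≤-trans (ℕ.+-monoˡ-≤ (sumℕ rest) (ℕ.≤-trans vl (term≤sumℕ v l)))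
      (ℕ.≤-reflexive (trans (sym (sumℕ-+ v rest)) (sumℕ-cong split)))
    restsol : rest · a ≡ 0ℤ
    restsol = trans (sym (ℤ.+-identityˡ _)) (trans (cong (_+ rest · a) (sym vsol))
      (trans (sym (·-+ v rest a)) (trans (·-congˡ {a = a} split) sol)))
  ... | k , e | y , f = (λ l → δ k l ℕ.+ y l) , λ j → begin
    + x j                                ≡⟨ cong +_ (sym (ℕ.m+[n∸m]≡n (v≤x j))) ⟩
    + v j + + (x j ℕ.∸ v j)
      ≡⟨ cong₂ _+_ (trans (cong +_ (e j)) (sym (δ-· k (λ l → + lookup basis l j)))) (f j) ⟩
    δ k · (λ l → + lookup basis l j) + y · (λ l → + lookup basis l j)
      ≡⟨ sym (·-+ (δ k) y (λ l → + lookup basis l j)) ⟩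
    (λ l → δ k l ℕ.+ y l) · (λ l → + lookup basis l j) ∎
    where open ≡-Reasoning

-- Substituting a basis for the first equation into the others leaves one equation fewer.
hilbertBasis : (A : Fin s → Fin n → ℤ) → HilbertBasis A
hilbertBasis {zero} {n} A = record
  { size = n ; vec = δ ; sound = λ k () ; complete = λ x _ → x , λ i → sym (identity x i) }
  where
  identity : (x : Fin n → ℕ) (i : Fin n) → x · (λ k → + δ k i) ≡ + x i
  identity x i = trans (sumℤ-cong (λ k → trans (ℤ.*-comm (+ x k) (+ δ k i))
    (cong (λ d → + d * + x k) (δ-sym k i)))) (δ-· i (λ k → + x k))
hilbertBasis {suc s} {n} A = record
  { size = T.size ; vec = vec
  ; sound = λ { l zero → trans (vec-· l (A zero))
                  (sumℤ-zero (λ k → trans (cong (+ T.vec l k *_) (F.sound k zero)) (ℤ.*-zeroʳ (+ T.vec l k))))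
              ; l (suc r) → trans (vec-· l (A (suc r))) (T.sound l r) }
  ; complete = complete }
  where
  module F = HilbertBasis (hilbertBasis₁ {n} (λ _ → A zero))
  -- The unknowns are now the multiplicities of the vectors of `F`; each remaining equation is
  -- evaluated on those vectors.
  A′ : Fin s → Fin F.size → ℤ
  A′ r k = F.vec k · A (suc r)
  module T = HilbertBasis (hilbertBasis {s} A′)
  vec : Fin T.size → Fin n → ℕ
  vec l i = sumℕ (λ k → T.vec l k ℕ.* F.vec k i)
  pos-vec : ∀ l i → + vec l i ≡ T.vec l · (λ k → + F.vec k i)
  pos-vec l i = trans (pos-sumℕ (λ k → T.vec l k ℕ.* F.vec k i)) (sumℤ-cong (λ k → ℤ.pos-* (T.vec l k) (F.vec k i)))
  combination-· : ∀ (x : Fin n → ℕ) y → (∀ i → + x i ≡ y · (λ k → + F.vec k i)) → ∀ b → x · b ≡ y · (λ k → F.vec k · b)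
  combination-· x y e b = trans (sumℤ-cong (λ i → cong (_* b i) (e i))) (·-assoc y (λ k i → + F.vec k i) b)
  vec-· : ∀ l b → vec l · b ≡ T.vec l · (λ k → F.vec k · b)
  vec-· l = combination-· (vec l) (T.vec l) (pos-vec l)
  complete : ∀ x → Kernel A x → ∃ λ y → ∀ i → + x i ≡ y · (λ k → + vec k i)
  complete x h with F.complete x (λ _ → h zero)
  ... | y , e with T.complete y (λ r → trans (sym (combination-· x y e (A (suc r)))) (h (suc r)))
  ...   | z , f = z , λ i → begin
    + x i                                                       ≡⟨ e i ⟩
    y · (λ k → + F.vec k i)
      ≡⟨ sumℤ-cong (λ k → cong (_* + F.vec k i) (f k)) ⟩
    sumℤ (λ k → z · (λ l → + T.vec l k) * + F.vec k i)
      ≡⟨ ·-assoc z (λ l k → + T.vec l k) (λ k → + F.vec k i) ⟩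
    z · (λ l → T.vec l · (λ k → + F.vec k i))
      ≡⟨ ·-congʳ {x = z} (λ l → sym (pos-vec l i)) ⟩
    z · (λ l → + vec l i)                                       ∎
    where open ≡-Reasoning

-- Multiples of a vector as natural combinations.

infix 4 _≤ᵛ_
_≤ᵛ_ : (Fin n → ℕ) → (Fin n → ℕ) → Set
x ≤ᵛ y = ∀ i → x i ≤ y i

term≤· : (y t : Fin n → ℕ) → ∀ k → + (y k ℕ.* t k) ℤ.≤ y · (λ k → + t k)
term≤· y t k = subst (ℤ._≤ y · (λ k → + t k)) (sym (ℤ.pos-* (y k) (t k)))
  (term≤sumℤ (λ i → subst (0ℤ ℤ.≤_) (ℤ.pos-* (y i) (t i)) (+≤+ z≤n)) k)

module Multiples (Y : Fin n → Vℤ s) (r : Vℤ s) where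

  Multiple : ℕ → (Fin n → ℕ) → Set
  Multiple t z = ∀ i → z · (λ j → Y j i) ≡ + t * r i

  -- Coordinate `zero` is the unknown multiplier `t` in `Y z = t r`.
  homogenised : Fin s → Fin (suc n) → ℤ
  homogenised i zero    = - r i
  homogenised i (suc j) = Y j i

  open HilbertBasis (hilbertBasis homogenised)

  kernel⇒multiple : ∀ x → Kernel homogenised x → Multiple (x zero) (x ∘ suc)
  kernel⇒multiple x h i = trans (sym (ℤ.+-identityˡ _))
    (trans (cong (_+ (x ∘ suc) · (λ j → Y j i)) (sym (ℤ.+-inverseʳ (+ x zero * r i))))
    (trans (regroup (+ x zero) (r i) _) (trans (cong (_+_ (+ x zero * r i)) (h i)) (ℤ.+-identityʳ _))))
    where
    regroup : ∀ t r z → t * r - t * r + z ≡ t * r + (t * (- r) + z)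
    regroup = solve-∀

  multiple⇒kernel : ∀ x → Multiple (x zero) (x ∘ suc) → Kernel homogenised x
  multiple⇒kernel x h i = trans (cong (_+_ (+ x zero * (- r i))) (h i)) (cancel (+ x zero) (r i))
    where
    cancel : ∀ t r → t * (- r) + t * r ≡ 0ℤ
    cancel = solve-∀

  private
    cons : ℕ → (Fin n → ℕ) → Fin (suc n) → ℕ
    cons t z zero    = t
    cons t z (suc j) = z j

  -- The multiplier of a natural combination of basis vectors is the same combination of their
  -- multipliers. It is positive for some solution exactly when it is positive for some basis
  -- vector.
  positive-multiple? : Dec (∃ λ q → ∃ λ z → Multiple (suc q) z)
  positive-multiple? with Fin.any? (λ k → 1 ℕ.≤? vec k zero)
  ... | yes (k , pos) with vec k zero in eq
  ...   | suc q = yes (q , vec k ∘ suc , λ i → trans (kernel⇒multiple (vec k) (sound k) i) (cong (λ t → + t * r i) eq))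
  positive-multiple? | no none = no λ { (q , z , h) → impossible q z h }
    where
    impossible : ∀ q z → ¬ Multiple (suc q) z
    impossible q z h with complete (cons (suc q) z) (multiple⇒kernel (cons (suc q) z) h)
    ... | y , e with trans (e zero) (sumℤ-zero (λ k → trans
            (cong (λ t → + y k * + t) (ℕ.n<1⇒n≡0 (ℕ.≰⇒> (λ le → none (k , le))))) (ℤ.*-zeroʳ (+ y k))))
    ...   | ()

  -- These vectors need not be minimal for `≤ᵛ`; what matters is that every solution with multiplier
  -- 1 lies above one of them.
  minimal : List (Fin n → ℕ)
  minimal = map (λ k → vec k ∘ suc) (filter (λ k → vec k zero ℕ.≟ 1) (allFin size))

  minimal-sound : ∀ {z} → z ∈ minimal → Multiple 1 z
  minimal-sound z∈ with ∈-map⁻ (λ k → vec k ∘ suc) z∈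
  ... | k , k∈ , refl with ∈-filter⁻ (λ k → vec k zero ℕ.≟ 1) {xs = allFin size} k∈
  ...   | _ , eq = λ i → trans (kernel⇒multiple (vec k) (sound k) i) (cong (λ t → + t * r i) eq)

  -- The multiplier 1 is a sum of the natural numbers `y k * vec k zero`, so one of these is 1 and
  -- both its factors are 1. That basis vector occurs in the sum for `z` and so lies below `z`.
  minimal-complete : ∀ z → Multiple 1 z → ∃ λ k → k ∈ minimal × k ≤ᵛ z
  minimal-complete z h with complete (cons 1 z) (multiple⇒kernel (cons 1 z) h)
  ... | y , e with Fin.any? (λ k → 1 ℕ.≤? y k ℕ.* vec k zero)
  ...   | yes (k , pos) = vec k ∘ suc
                        , ∈-map⁺ (λ k → vec k ∘ suc) (∈-filter⁺ (λ k → vec k zero ℕ.≟ 1) (∈-allFin k) tk≡1)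
                        , λ i → ℕ.≤-trans (ℕ.≤-reflexive (sym (trans (cong (ℕ._* vec k (suc i)) yk≡1) (ℕ.*-identityˡ _))))
                                          (below (suc i))
    where
    below : ∀ i → y k ℕ.* vec k i ≤ cons 1 z i
    below i = ℤ.drop‿+≤+ (subst (+ (y k ℕ.* vec k i) ℤ.≤_) (sym (e i)) (term≤· y (λ k → vec k i) k))
    prod≡1 : y k ℕ.* vec k zero ≡ 1
    prod≡1 = ℕ.≤-antisym (below zero) pos
    yk≡1 = ℕ.m*n≡1⇒m≡1 (y k) (vec k zero) prod≡1
    tk≡1 = ℕ.m*n≡1⇒n≡1 (y k) (vec k zero) prod≡1
  ...   | no none with trans (e zero) (sumℤ-zero (λ k → trans (sym (ℤ.pos-* (y k) (vec k zero)))
                         (cong +_ (ℕ.n<1⇒n≡0 (ℕ.≰⇒> (λ le → none (k , le)))))))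
  ...     | ()

-- Finitely generated upward closed sets of coefficient vectors

record FinitelyGeneratedUpSet (P : (Fin m → ℕ) → Set) : Set where
  field
    upward     : ∀ {c d} → c ≤ᵛ d → P c → P d
    generators : List (Fin m → ℕ)
    sound      : ∀ {k} → k ∈ generators → P k
    complete   : ∀ c → P c → ∃ λ k → k ∈ generators × k ≤ᵛ c
    inhabited  : ∃ P

everything : {P : (Fin m → ℕ) → Set} → (∀ c → P c) → FinitelyGeneratedUpSet P
everything all = record
  { upward = λ {_} {d} _ _ → all d ; generators = (λ _ → 0) ∷ []
  ; sound = λ {k} _ → all k ; complete = λ c _ → (λ _ → 0) , here refl , λ _ → z≤n
  ; inhabited = (λ _ → 0) , all _ }

-- A vector lies above both `k` and `l` exactly when it lies above their join. `R` is tied to `P`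
-- and `Q` by `to` and `from`, so that any form of the conjunction fits.
intersection : {P Q R : (Fin m → ℕ) → Set} → FinitelyGeneratedUpSet P → FinitelyGeneratedUpSet Q →
  (∀ {c} → P c → Q c → R c) → (∀ {c} → R c → P c × Q c) → FinitelyGeneratedUpSet R
intersection {m} {P} {Q} {R} up up′ to from = record
  { upward = λ le rc → to (F.upward le (proj₁ (from rc))) (G.upward le (proj₂ (from rc)))
  ; generators = cartesianProductWith join F.generators G.generators
  ; sound = snd
  ; complete = cmp
  ; inhabited = join (proj₁ F.inhabited) (proj₁ G.inhabited) , join-sound (proj₂ F.inhabited) (proj₂ G.inhabited) }
  where
  module F = FinitelyGeneratedUpSet up
  module G = FinitelyGeneratedUpSet up′
  join : (Fin m → ℕ) → (Fin m → ℕ) → Fin m → ℕ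
  join c d i = c i ⊔ d i
  join-sound : ∀ {c d} → P c → Q d → R (join c d)
  join-sound {c} {d} pc qd = to (F.upward (λ i → ℕ.m≤m⊔n (c i) (d i)) pc) (G.upward (λ i → ℕ.m≤n⊔m (c i) (d i)) qd)
  snd : ∀ {k} → k ∈ cartesianProductWith join F.generators G.generators → R k
  snd k∈ with ∈-cartesianProductWith⁻ join F.generators G.generators k∈
  ... | c , d , c∈ , d∈ , refl = join-sound (F.sound c∈) (G.sound d∈)
  cmp : ∀ c → R c → ∃ λ k → k ∈ cartesianProductWith join F.generators G.generators × k ≤ᵛ c
  cmp c rc with F.complete c (proj₁ (from rc)) | G.complete c (proj₂ (from rc))
  ... | k , k∈ , k≤ | l , l∈ , l≤ = join k l , ∈-cartesianProductWith⁺ join k∈ l∈ , λ i → ℕ.⊔-lub (k≤ i) (l≤ i)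

-- Block sums, absolute values and integer intervals.

sumℤ-++ : (m : ℕ) (f : Fin (m ℕ.+ n) → ℤ) → sumℤ f ≡ sumℤ (λ j → f (j ↑ˡ n)) + sumℤ (λ j → f (m ↑ʳ j))
sumℤ-++ zero    f = sym (ℤ.+-identityˡ _)
sumℤ-++ {n} (suc m) f = trans (cong (_+_ (f zero)) (sumℤ-++ m (f ∘ suc))) (sym (ℤ.+-assoc (f zero) _ _))

∣sumℤ∣≤ : (f : Fin n → ℤ) → ∣ sumℤ f ∣ ≤ sumℕ (λ i → ∣ f i ∣)
∣sumℤ∣≤ {zero}  f = z≤n
∣sumℤ∣≤ {suc n} f = ℕ.≤-trans (ℤ.∣i+j∣≤∣i∣+∣j∣ (f zero) _) (ℕ.+-monoʳ-≤ ∣ f zero ∣ (∣sumℤ∣≤ (f ∘ suc)))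

sumℕ-* : (c : ℕ) (f : Fin n → ℕ) → sumℕ (λ i → c ℕ.* f i) ≡ c ℕ.* sumℕ f
sumℕ-* {zero}  c f = sym (ℕ.*-zeroʳ c)
sumℕ-* {suc n} c f rewrite sumℕ-* c (f ∘ suc) = sym (ℕ.*-distribˡ-+ c _ _)

interval : ℕ → List ℤ
interval b = map +_ (upTo (suc b)) ++ map (λ k → - (+ k)) (upTo (suc b))

interval-complete : ∀ {b} z → ∣ z ∣ ≤ b → z ∈ interval b
interval-complete (+ k)      le = ∈-++⁺ˡ (∈-map⁺ +_ (∈-upTo⁺ (s≤s le)))
interval-complete {b} (-[1+ k ]) le = ∈-++⁺ʳ (map +_ (upTo (suc b))) (∈-map⁺ (λ k → - (+ k)) (∈-upTo⁺ (s≤s le)))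

-- Saturation in terms of integer coefficients

module Lattice (X : Fin m → Vℤ s) where

  comb : (Fin m → ℕ) → Vℤ s
  comb c i = c · (λ j → X j i)

  -- Membership in the cone for an integer vector, freed of rationals: the positive factor `suc q`
  -- clears the denominators of the coefficients.
  Cone : Vℤ s → Set
  Cone v = ∃ λ q → ∃ λ d → ∀ i → comb d i ≡ + suc q * v i

  Translate : Vℤ s → (Fin m → ℕ) → Set
  Translate r c = InJ X (λ i → comb c i + r i)

  translate-upward : ∀ r {c d} → c ≤ᵛ d → Translate r c → Translate r d
  translate-upward r {c} {d} le (e , h) = (λ j → e j ℕ.+ (d j ℕ.∸ c j)) , λ i → begin
    comb d i + r i
      ≡⟨ cong (_+ r i) (·-congˡ {a = λ j → X j i} (λ j → sym (ℕ.m+[n∸m]≡n (le j)))) ⟩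
    comb (λ j → c j ℕ.+ (d j ℕ.∸ c j)) i + r i
      ≡⟨ cong (_+ r i) (·-+ c (λ j → d j ℕ.∸ c j) (λ j → X j i)) ⟩
    comb c i + comb (λ j → d j ℕ.∸ c j) i + r i        ≡⟨ swap (comb c i) _ (r i) ⟩
    (comb c i + r i) + comb (λ j → d j ℕ.∸ c j) i      ≡⟨ cong (_+ comb (λ j → d j ℕ.∸ c j) i) (h i) ⟩
    comb e i + comb (λ j → d j ℕ.∸ c j) i              ≡⟨ sym (·-+ e (λ j → d j ℕ.∸ c j) (λ j → X j i)) ⟩
    comb (λ j → e j ℕ.+ (d j ℕ.∸ c j)) i               ∎
    where
    open ≡-Reasoning
    swap : ∀ a b c → a + b + c ≡ a + c + b
    swap = solve-∀

  module _ (r : Vℤ s) where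

    -- comb c + r ∈ 𝒥 says that r is an ℕ-combination of the columns of [X | −X]
    -- with −X having coefficients c.
    doubled : Fin (m ℕ.+ m) → Vℤ s
    doubled j = [ X , (λ k i → - X k i) ]′ (splitAt m j)

    open Multiples doubled r

    doubled-· : ∀ z i → z · (λ j → doubled j i) ≡ comb (z ∘ (_↑ˡ m)) i - comb (z ∘ (m ↑ʳ_)) i
    doubled-· z i = trans (sumℤ-++ m (λ j → + z j * doubled j i)) (cong₂ _+_
      (sumℤ-cong (λ j → cong (λ u → + z (j ↑ˡ m) * [ X , (λ k i → - X k i) ]′ u i) (Fin.splitAt-↑ˡ m j m)))
      (trans (sumℤ-cong (λ j → cong (λ u → + z (m ↑ʳ j) * [ X , (λ k i → - X k i) ]′ u i) (Fin.splitAt-↑ʳ m m j)))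
             (·-neg (z ∘ (m ↑ʳ_)) (λ j → X j i))))

    translate-generators : List (Fin m → ℕ)
    translate-generators = map (_∘ (m ↑ʳ_)) minimal

    translate-sound : ∀ {c} → c ∈ translate-generators → Translate r c
    translate-sound c∈ with ∈-map⁻ (_∘ (m ↑ʳ_)) c∈
    ... | z , z∈ , refl = z ∘ (_↑ˡ m) , λ i → trans
      (cong (_+_ (comb (z ∘ (m ↑ʳ_)) i)) (trans (sym (ℤ.*-identityˡ (r i)))
        (trans (sym (minimal-sound z∈ i)) (doubled-· z i))))
      (cancel (comb (z ∘ (m ↑ʳ_)) i) _)
      where
      cancel : ∀ a b → a + (b - a) ≡ b
      cancel = solve-∀

    -- A representation `d` of `comb c + r` gives the solution `(d , c)` of the doubled system. A
    -- member of `minimal` below it projects to a generator below `c`.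
    translate-complete : ∀ c → Translate r c → ∃ λ k → k ∈ translate-generators × k ≤ᵛ c
    translate-complete c (d , h) = let k , k∈ , k≤ = minimal-complete z multiple in
      k ∘ (m ↑ʳ_) , ∈-map⁺ (_∘ (m ↑ʳ_)) k∈
      , λ j → subst (k (m ↑ʳ j) ≤_) (cong [ d , c ]′ (Fin.splitAt-↑ʳ m m j)) (k≤ (m ↑ʳ j))
      where
      z : Fin (m ℕ.+ m) → ℕ
      z j = [ d , c ]′ (splitAt m j)
      cancel : ∀ a b → (a + b) - a ≡ + 1 * b
      cancel = solve-∀
      multiple : Multiple 1 z
      multiple i = trans (doubled-· z i) (trans (cong₂ _-_
        (trans (·-congˡ {a = λ j → X j i} (λ j → cong [ d , c ]′ (Fin.splitAt-↑ˡ m j m))) (sym (h i)))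
        (·-congˡ {a = λ j → X j i} (λ j → cong [ d , c ]′ (Fin.splitAt-↑ʳ m m j))))
        (cancel (comb c i) (r i)))

    cone? : Dec (Cone r)
    cone? = Multiples.positive-multiple? X r

    -- Each integer coefficient is a difference of natural numbers; the negative parts form `c` and
    -- the positive parts represent the sum.
    lattice⇒translate : InL X r → ∃ (Translate r)
    lattice⇒translate (z , h) = c , d , λ i → trans (cong (_+_ (comb c i)) (h i))
      (trans (sym (sumℤ-+ (λ j → + c j * X j i) (λ j → z j * X j i)))
             (sumℤ-cong (λ j → trans (sym (ℤ.*-distribʳ-+ (X j i) (+ c j) (z j))) (cong (_* X j i) (split (z j))))))
      where
      neg pos : ℤ → ℕ
      neg (+ n)    = 0
      neg -[1+ n ] = suc n
      pos (+ n)    = n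
      pos -[1+ n ] = 0
      split : ∀ z → + neg z + z ≡ + pos z
      split (+ n)    = refl
      split -[1+ n ] = ℤ.+-inverseʳ (+ suc n)
      c = neg ∘ z
      d = pos ∘ z

  SaturatedAt : Vℤ s → (Fin m → ℕ) → Set
  SaturatedAt r c = InL X r → Cone r → Translate r c

  -- Membership of `r` in the cone is decided by `cone?`, membership in the lattice by whether
  -- `translate-generators r` is empty. If either fails, the condition is vacuous; otherwise it
  -- amounts to `Translate r`.
  saturatedAt-upset : ∀ r → FinitelyGeneratedUpSet (SaturatedAt r)
  saturatedAt-upset r with cone? r
  ... | no ¬cone = everything (λ c _ cone → contradiction cone ¬cone)
  ... | yes cone with translate-generators r in eq
  ...   | [] = everything λ c inL _ → contradiction (lattice⇒translate r inL) none
    where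
    none : ¬ ∃ (Translate r)
    none (c , t) = let k , k∈ , _ = translate-complete r c t in ¬Any[] (subst (k ∈_) eq k∈)
  ...   | k₀ ∷ ks = record
    { upward = λ le t inL cn → translate-upward r le (t inL cn)
    ; generators = translate-generators r
    ; sound = λ k∈ _ _ → translate-sound r k∈
    ; complete = λ c t → translate-complete r c (t inL cone)
    ; inhabited = k₀ , λ _ _ → k₀-translate }
    where
    k₀-translate : Translate r k₀
    k₀-translate = translate-sound r (subst (k₀ ∈_) (sym eq) (here refl))
    negate : ∀ a b r → a + r ≡ b → r ≡ b - a
    negate a b r refl = solve a r
      where
      solve : ∀ a r → r ≡ a + r - a
      solve = solve-∀
    -- With a generator at hand, `r` is a difference of two elements of the semigroup and so lies in
    -- the lattice.
    inL : InL X r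
    inL = (λ j → + proj₁ k₀-translate j - + k₀ j) , λ i → trans
      (negate (comb k₀ i) (comb (proj₁ k₀-translate) i) (r i) (proj₂ k₀-translate i))
      (trans (cong (_+_ (comb (proj₁ k₀-translate) i)) (sym (sumℤ-neg (λ j → + k₀ j * X j i))))
      (trans (sym (sumℤ-+ (λ j → + proj₁ k₀-translate j * X j i) (λ j → - (+ k₀ j * X j i))))
      (sumℤ-cong (λ j → distrib (+ proj₁ k₀-translate j) (+ k₀ j) (X j i)))))
      where
      distrib : ∀ a b x → a * x + - (b * x) ≡ (a - b) * x
      distrib = solve-∀

  saturatedOn-upset : (R : List (Vℤ s)) → FinitelyGeneratedUpSet (λ c → ∀ {r} → r ∈ R → SaturatedAt r c)
  saturatedOn-upset []      = everything (λ c ())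
  saturatedOn-upset (r ∷ R) = intersection (saturatedAt-upset r) (saturatedOn-upset R)
    (λ {c} hr hR → λ { (here refl) → hr ; (there r∈) → hR r∈ }) (λ h → h (here refl) , λ r∈ → h (there r∈))

  -- One bound serves all coordinates because `tuples` draws every entry from the same list; hence
  -- the sum over both indices.
  box : List (Vℤ s)
  box = tuples s (interval (sumℕ (λ i → sumℕ (λ j → ∣ X j i ∣))))

  SaturatedCoefficients : (Fin m → ℕ) → Set
  SaturatedCoefficients c = ∀ {r} → r ∈ box → SaturatedAt r c

  SaturatedInJ : Vℤ s → Set
  SaturatedInJ g = ∀ h → InL X h → Cone (λ i → h i - g i) → InJ X h

  saturated⇒coefficients : ∀ {g} c → g ≗ comb c → SaturatedInJ g → SaturatedCoefficients c
  saturated⇒coefficients {g} c e sat {r} _ (z , hz) (q , d , hd) =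
    sat (λ i → comb c i + r i)
        ((λ j → + c j + z j) , λ i → trans (cong (_+_ (comb c i)) (hz i))
          (trans (sym (sumℤ-+ (λ j → + c j * X j i) (λ j → z j * X j i)))
                 (sumℤ-cong (λ j → sym (ℤ.*-distribʳ-+ (X j i) (+ c j) (z j))))))
        (q , d , λ i → trans (hd i) (cong (_*_ (+ suc q))
          (trans (cancel (comb c i) (r i)) (cong (λ x → comb c i + r i - x) (sym (e i))))))
    where
    cancel : ∀ a b → b ≡ a + b - a
    cancel = solve-∀

  -- Division with remainder by the common denominator moves h − g into the zonotope of X,
  -- whose lattice points all lie in the box.
  coefficients⇒saturated : ∀ {g} c → g ≗ comb c → SaturatedCoefficients c → SaturatedInJ g
  coefficients⇒saturated {g} c e coeff h (z , hz) (q , d , hd) =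
    (λ j → proj₁ r′-translate j ℕ.+ u j) , λ i → begin
      h i                                       ≡⟨ restore (h i) (g i) (comb u i) ⟩
      g i + r i + comb u i                      ≡⟨ cong₂ (λ a b → a + b + comb u i) (e i) (r≗r′ i) ⟩
      comb c i + r′ i + comb u i                ≡⟨ cong (_+ comb u i) (proj₂ r′-translate i) ⟩
      comb (proj₁ r′-translate) i + comb u i    ≡⟨ sym (·-+ (proj₁ r′-translate) u (λ j → X j i)) ⟩
      comb (λ j → proj₁ r′-translate j ℕ.+ u j) i ∎
    where
    open ≡-Reasoning
    restore : ∀ h g u → h ≡ g + (h - g - u) + u
    restore = solve-∀
    -- The quotients `u` are split off as a natural combination; the remainders `v`, all below
    -- `suc q`, keep `r` in the cone and bound it.
    u v : Fin m → ℕ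
    u j = d j ℕ./ suc q
    v j = d j ℕ.% suc q
    r : Vℤ s
    r i = h i - g i - comb u i
    remainder : ∀ i → comb v i ≡ + suc q * r i
    remainder i = begin
      comb v i                                          ≡⟨ add-sub (comb v i) (+ suc q * comb u i) ⟩
      comb v i + + suc q * comb u i - + suc q * comb u i ≡⟨ cong (_- + suc q * comb u i) (sym d-split) ⟩
      comb d i - + suc q * comb u i                      ≡⟨ cong (_- + suc q * comb u i) (hd i) ⟩
      + suc q * (h i - g i) - + suc q * comb u i         ≡⟨ factor (+ suc q) (h i - g i) (comb u i) ⟩
      + suc q * r i                                      ∎
      where
      add-sub : ∀ a b → a ≡ a + b - b
      add-sub = solve-∀
      factor : ∀ q a b → q * a - q * b ≡ q * (a - b)
      factor = solve-∀
      d-split : comb d i ≡ comb v i + + suc q * comb u i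
      d-split = trans (·-congˡ {a = λ j → X j i} (λ j →
          trans (ℕ.m≡m%n+[m/n]*n (d j) (suc q)) (cong (v j ℕ.+_) (ℕ.*-comm (u j) (suc q)))))
        (trans (·-+ v (λ j → suc q ℕ.* u j) (λ j → X j i)) (cong (_+_ (comb v i)) (·-* (suc q) u (λ j → X j i))))
    -- The factor `suc q` bounds each `v j` and cancels against the one on `r`.
    small : ∀ i → ∣ r i ∣ ≤ sumℕ (λ j → ∣ X j i ∣)
    small i = ℕ.*-cancelˡ-≤ (suc q) (ℕ.≤-trans
      (ℕ.≤-reflexive (trans (sym (ℤ.∣i*j∣≡∣i∣*∣j∣ (+ suc q) (r i))) (cong ∣_∣ (sym (remainder i)))))
      (ℕ.≤-trans (∣sumℤ∣≤ (λ j → + v j * X j i)) (ℕ.≤-trans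
        (sumℕ-mono (λ j → ℕ.≤-trans (ℕ.≤-reflexive (ℤ.∣i*j∣≡∣i∣*∣j∣ (+ v j) (X j i)))
                                     (ℕ.*-monoˡ-≤ ∣ X j i ∣ (ℕ.<⇒≤ (ℕ.m%n<n (d j) (suc q))))))
        (ℕ.≤-reflexive (sumℕ-* (suc q) (λ j → ∣ X j i ∣))))))
    r-in-box : ∃ λ r′ → r′ ∈ box × r ≗ r′
    r-in-box = tuples-complete (interval (sumℕ (λ i → sumℕ (λ j → ∣ X j i ∣)))) r
      (λ i → interval-complete (r i) (ℕ.≤-trans (small i) (term≤sumℕ (λ i → sumℕ (λ j → ∣ X j i ∣)) i)))
    r′ = proj₁ r-in-box
    r≗r′ = proj₂ (proj₂ r-in-box)
    r-lattice : ∀ i → r i ≡ sumℤ (λ j → (z j - + c j - + u j) * X j i)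
    r-lattice i = begin
      h i - g i - comb u i
        ≡⟨ cong₂ (λ a b → a - b - comb u i) (hz i) (e i) ⟩
      sumℤ (λ j → z j * X j i) - comb c i - comb u i
        ≡⟨ cong₂ (λ a b → sumℤ (λ j → z j * X j i) + a + b)
                                                                  (sym (sumℤ-neg (λ j → + c j * X j i))) (sym (sumℤ-neg (λ j → + u j * X j i))) ⟩
      sumℤ (λ j → z j * X j i) + sumℤ (λ j → - (+ c j * X j i)) + sumℤ (λ j → - (+ u j * X j i))
        ≡⟨ cong (_+ sumℤ (λ j → - (+ u j * X j i))) (sym (sumℤ-+ (λ j → z j * X j i) (λ j → - (+ c j * X j i)))) ⟩
      sumℤ (λ j → z j * X j i + - (+ c j * X j i)) + sumℤ (λ j → - (+ u j * X j i))
        ≡⟨ sym (sumℤ-+ (λ j → z j * X j i + - (+ c j * X j i)) (λ j → - (+ u j * X j i))) ⟩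
      sumℤ (λ j → z j * X j i + - (+ c j * X j i) + - (+ u j * X j i))
        ≡⟨ sumℤ-cong (λ j → distrib (z j) (+ c j) (+ u j) (X j i)) ⟩
      sumℤ (λ j → (z j - + c j - + u j) * X j i) ∎
      where
      distrib : ∀ z c u x → z * x + - (c * x) + - (u * x) ≡ (z - c - u) * x
      distrib = solve-∀
    r′-translate : Translate r′ c
    r′-translate = coeff (proj₁ (proj₂ r-in-box))
      ((λ j → z j - + c j - + u j) , λ i → trans (sym (r≗r′ i)) (r-lattice i))
      (q , v , λ i → trans (remainder i) (cong (_*_ (+ suc q)) (r≗r′ i)))

-- Rational cones

sumℚ-cong : {f g : Fin n → ℚ} → f ≗ g → sumℚ f ≡ sumℚ g
sumℚ-cong {zero}  e = refl
sumℚ-cong {suc n} e = cong₂ ℚ._+_ (e zero) (sumℚ-cong (e ∘ suc))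

sumℚ-+ : (f g : Fin n → ℚ) → sumℚ (λ i → f i ℚ.+ g i) ≡ sumℚ f ℚ.+ sumℚ g
sumℚ-+ {zero}  f g = refl
sumℚ-+ {suc n} f g = begin
  f zero ℚ.+ g zero ℚ.+ sumℚ (λ i → f (suc i) ℚ.+ g (suc i))
    ≡⟨ cong (ℚ._+_ (f zero ℚ.+ g zero)) (sumℚ-+ (f ∘ suc) (g ∘ suc)) ⟩
  f zero ℚ.+ g zero ℚ.+ (F ℚ.+ G)     ≡⟨ ℚ.+-assoc (f zero) (g zero) _ ⟩
  f zero ℚ.+ (g zero ℚ.+ (F ℚ.+ G))   ≡⟨ cong (ℚ._+_ (f zero)) (sym (ℚ.+-assoc (g zero) F G)) ⟩
  f zero ℚ.+ (g zero ℚ.+ F ℚ.+ G)     ≡⟨ cong (λ z → f zero ℚ.+ (z ℚ.+ G)) (ℚ.+-comm (g zero) F) ⟩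
  f zero ℚ.+ (F ℚ.+ g zero ℚ.+ G)     ≡⟨ cong (ℚ._+_ (f zero)) (ℚ.+-assoc F (g zero) G) ⟩
  f zero ℚ.+ (F ℚ.+ (g zero ℚ.+ G))   ≡⟨ sym (ℚ.+-assoc (f zero) F _) ⟩
  f zero ℚ.+ F ℚ.+ (g zero ℚ.+ G)     ∎
  where
  open ≡-Reasoning
  F = sumℚ (f ∘ suc)
  G = sumℚ (g ∘ suc)

sumℚ-* : (c : ℚ) (f : Fin n → ℚ) → sumℚ (λ i → c ℚ.* f i) ≡ c ℚ.* sumℚ f
sumℚ-* {zero}  c f = sym (ℚ.*-zeroʳ c)
sumℚ-* {suc n} c f = trans (cong (ℚ._+_ (c ℚ.* f zero)) (sumℚ-* c (f ∘ suc))) (sym (ℚ.*-distribˡ-+ c (f zero) _))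

-- `toℚ` normalises its result, which blocks computation on variables. Passing to unnormalised
-- rationals turns the laws below into integer identities.
toℚᵘ-toℚ : ∀ z → toℚᵘ (toℚ z) ℚᵘ.≃ mkℚᵘ z 0
toℚᵘ-toℚ z = ℚ.toℚᵘ-fromℚᵘ (mkℚᵘ z 0)

toℚ-+ : ∀ a b → toℚ (a + b) ≡ toℚ a ℚ.+ toℚ b
toℚ-+ a b = ℚ.toℚᵘ-injective (ℚᵘ.≃-trans (toℚᵘ-toℚ (a + b)) (ℚᵘ.≃-trans (*≡* (numerators a b))
  (ℚᵘ.≃-sym (ℚᵘ.≃-trans (ℚ.toℚᵘ-homo-+ (toℚ a) (toℚ b)) (ℚᵘ.+-cong (toℚᵘ-toℚ a) (toℚᵘ-toℚ b))))))
  where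
  numerators : ∀ a b → (a + b) * + 1 ≡ (a * + 1 + b * + 1) * + 1
  numerators = solve-∀

toℚ-* : ∀ a b → toℚ (a * b) ≡ toℚ a ℚ.* toℚ b
toℚ-* a b = ℚ.toℚᵘ-injective (ℚᵘ.≃-trans (toℚᵘ-toℚ (a * b)) (ℚᵘ.≃-trans (*≡* refl)
  (ℚᵘ.≃-sym (ℚᵘ.≃-trans (ℚ.toℚᵘ-homo-* (toℚ a) (toℚ b)) (ℚᵘ.*-cong (toℚᵘ-toℚ a) (toℚᵘ-toℚ b))))))

toℚ-sum : (f : Fin n → ℤ) → toℚ (sumℤ f) ≡ sumℚ (λ i → toℚ (f i))
toℚ-sum {zero}  f = refl
toℚ-sum {suc n} f = trans (toℚ-+ (f zero) (sumℤ (f ∘ suc))) (cong (ℚ._+_ (toℚ (f zero))) (toℚ-sum (f ∘ suc)))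

toℚ-injective : ∀ {a b} → toℚ a ≡ toℚ b → a ≡ b
toℚ-injective {a} {b} e
  with ℚᵘ.≃-trans (ℚᵘ.≃-sym (toℚᵘ-toℚ a)) (ℚᵘ.≃-trans (ℚᵘ.≃-reflexive (cong toℚᵘ e)) (toℚᵘ-toℚ b))
... | *≡* h = trans (sym (ℤ.*-identityʳ a)) (trans h (ℤ.*-identityʳ b))

toℚ-mono-≤ : ∀ {a b} → a ℤ.≤ b → toℚ a ℚ.≤ toℚ b
toℚ-mono-≤ {a} {b} le = ℚ.toℚᵘ-cancel-≤ (ℚᵘ.≤-respˡ-≃ (ℚᵘ.≃-sym (toℚᵘ-toℚ a)) (ℚᵘ.≤-respʳ-≃ (ℚᵘ.≃-sym (toℚᵘ-toℚ b))
  (*≤* (ℤ.*-monoʳ-≤-nonNeg (+ 1) le))))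

toℚ-cancel-≤ : ∀ {a b} → toℚ a ℚ.≤ toℚ b → a ℤ.≤ b
toℚ-cancel-≤ {a} {b} le with ℚᵘ.≤-respˡ-≃ (toℚᵘ-toℚ a) (ℚᵘ.≤-respʳ-≃ (toℚᵘ-toℚ b) (ℚ.toℚᵘ-mono-≤ le))
... | *≤* h = subst₂ ℤ._≤_ (ℤ.*-identityʳ a) (ℤ.*-identityʳ b) h

toℚ-cancel-< : ∀ {a b} → toℚ a ℚ.< toℚ b → a ℤ.< b
toℚ-cancel-< {a} {b} lt with ℚᵘ.<-respˡ-≃ (toℚᵘ-toℚ a) (ℚᵘ.<-respʳ-≃ (toℚᵘ-toℚ b) (ℚ.toℚᵘ-mono-< lt))
... | *<* h = subst₂ ℤ._<_ (ℤ.*-identityʳ a) (ℤ.*-identityʳ b) h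

clear-denominator : ∀ x → ∃ λ q → ∃ λ z → toℚ (+ suc q) ℚ.* x ≡ toℚ z
clear-denominator x@(mkℚ z q _) = q , z , ℚ.toℚᵘ-injective (ℚᵘ.≃-trans (ℚ.toℚᵘ-homo-* (toℚ (+ suc q)) x)
  (ℚᵘ.≃-trans (ℚᵘ.*-congʳ (toℚᵘ-toℚ (+ suc q))) (ℚᵘ.≃-trans (*≡* (numerators (+ suc q) z)) (ℚᵘ.≃-sym (toℚᵘ-toℚ z)))))
  where
  numerators : ∀ q z → q * z * + 1 ≡ z * (+ 1 * q)
  numerators = solve-∀

clear-denominators : (f : Fin n → ℚ) → ∃ λ q → ∃ λ (d : Fin n → ℤ) → ∀ j → toℚ (+ suc q) ℚ.* f j ≡ toℚ (d j)
clear-denominators {zero}  f = 0 , (λ ()) , λ ()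
clear-denominators {suc n} f with clear-denominator (f zero) | clear-denominators (f ∘ suc)
-- The number `q + p * suc q` is the predecessor of `suc p * suc q`, the product of the two
-- denominators.
... | p , z , e | q , d , h = q ℕ.+ p ℕ.* suc q , D , H
  where
  D : Fin (suc n) → ℤ
  D zero    = + suc q * z
  D (suc j) = + suc p * d j
  scale : ∀ a b c x y → c ≡ a * b → toℚ b ℚ.* x ≡ toℚ y → toℚ c ℚ.* x ≡ toℚ (a * y)
  scale a b c x y refl h = begin
    toℚ (a * b) ℚ.* x         ≡⟨ cong (ℚ._* x) (toℚ-* a b) ⟩
    toℚ a ℚ.* toℚ b ℚ.* x     ≡⟨ ℚ.*-assoc (toℚ a) (toℚ b) x ⟩
    toℚ a ℚ.* (toℚ b ℚ.* x)   ≡⟨ cong (ℚ._*_ (toℚ a)) h ⟩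
    toℚ a ℚ.* toℚ y           ≡⟨ sym (toℚ-* a y) ⟩
    toℚ (a * y)               ∎
    where open ≡-Reasoning
  H : ∀ j → toℚ (+ suc (q ℕ.+ p ℕ.* suc q)) ℚ.* f j ≡ toℚ (D j)
  H zero    = scale (+ suc q) (+ suc p) _ (f zero) z (trans (ℤ.pos-* (suc p) (suc q)) (ℤ.*-comm (+ suc p) (+ suc q))) e
  H (suc j) = scale (+ suc p) (+ suc q) _ (f (suc j)) (d j) (ℤ.pos-* (suc p) (suc q)) (h j)

inverse : ∀ q → ∃ λ ι → 0ℚ ℚ.≤ ι × ι ℚ.* toℚ (+ suc q) ≡ 1ℚ
inverse q = fromℚᵘ (mkℚᵘ (+ 1) q)
  , ℚ.toℚᵘ-cancel-≤ (ℚᵘ.≤-respʳ-≃ (ℚᵘ.≃-sym (ℚ.toℚᵘ-fromℚᵘ (mkℚᵘ (+ 1) q))) (*≤* (+≤+ z≤n)))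
  , ℚ.toℚᵘ-injective (ℚᵘ.≃-trans (ℚ.toℚᵘ-homo-* (fromℚᵘ (mkℚᵘ (+ 1) q)) (toℚ (+ suc q)))
      (ℚᵘ.≃-trans (ℚᵘ.*-cong (ℚ.toℚᵘ-fromℚᵘ (mkℚᵘ (+ 1) q)) (toℚᵘ-toℚ (+ suc q))) (*≡* (numerators (+ suc q)))))
  where
  numerators : ∀ q → + 1 * q * + 1 ≡ + 1 * (q * + 1)
  numerators = solve-∀

-- Rational and integral descriptions of the cone.

module RationalCone (X : Fin m → Vℤ s) where
  open Lattice X

  -- Multiplication by a common denominator makes the coefficients integers. They are non-negative,
  -- so taking absolute values turns them into natural numbers of the same value.
  inCone⇒cone : (g h : Vℤ s) → InCone X g (λ i → toℚ (h i)) → Cone (λ i → h i - g i)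
  inCone⇒cone g h (μ , μ≥0 , e) with clear-denominators μ
  ... | q , d , clear = q , (λ j → ∣ d j ∣) , λ i → trans
      (sumℤ-cong (λ j → cong (_* X j i) (ℤ.0≤i⇒+∣i∣≡i (d≥0 j))))
      (isolate (+ suc q) (h i) (g i) _ (toℚ-injective (scaled i)))
    where
    Q = toℚ (+ suc q)
    isolate : ∀ q h g z → q * h ≡ q * g + z → z ≡ q * (h - g)
    isolate q h g z eq = trans (ring₁ (q * g) z) (trans (cong (_- q * g) (sym eq)) (ring₂ q h g))
      where
      ring₁ : ∀ a z → z ≡ a + z - a
      ring₁ = solve-∀
      ring₂ : ∀ q h g → q * h - q * g ≡ q * (h - g)
      ring₂ = solve-∀
    d≥0 : ∀ j → 0ℤ ℤ.≤ d j
    d≥0 j = toℚ-cancel-≤ (subst₂ ℚ._≤_ (ℚ.*-zeroʳ Q) (clear j)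
      (ℚ.*-monoˡ-≤-nonNeg Q ⦃ ℚ.nonNegative (toℚ-mono-≤ {0ℤ} {+ suc q} (+≤+ z≤n)) ⦄ (μ≥0 j)))
    scaled : ∀ i → toℚ (+ suc q * h i) ≡ toℚ (+ suc q * g i + sumℤ (λ j → d j * X j i))
    scaled i = begin
      toℚ (+ suc q * h i)                                          ≡⟨ toℚ-* (+ suc q) (h i) ⟩
      Q ℚ.* toℚ (h i)                                              ≡⟨ cong (ℚ._*_ Q) (e i) ⟩
      Q ℚ.* (toℚ (g i) ℚ.+ sumℚ (λ j → μ j ℚ.* toℚ (X j i)))       ≡⟨ ℚ.*-distribˡ-+ Q (toℚ (g i)) _ ⟩
      Q ℚ.* toℚ (g i) ℚ.+ Q ℚ.* sumℚ (λ j → μ j ℚ.* toℚ (X j i))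
        ≡⟨ cong₂ ℚ._+_ (sym (toℚ-* (+ suc q) (g i))) (sym (sumℚ-* Q (λ j → μ j ℚ.* toℚ (X j i)))) ⟩
      toℚ (+ suc q * g i) ℚ.+ sumℚ (λ j → Q ℚ.* (μ j ℚ.* toℚ (X j i)))
        ≡⟨ cong (ℚ._+_ (toℚ (+ suc q * g i))) (sumℚ-cong (λ j → trans (sym (ℚ.*-assoc Q (μ j) (toℚ (X j i))))
             (trans (cong (ℚ._* toℚ (X j i)) (clear j)) (sym (toℚ-* (d j) (X j i)))))) ⟩
      toℚ (+ suc q * g i) ℚ.+ sumℚ (λ j → toℚ (d j * X j i))
        ≡⟨ cong (ℚ._+_ (toℚ (+ suc q * g i))) (sym (toℚ-sum (λ j → d j * X j i))) ⟩
      toℚ (+ suc q * g i) ℚ.+ toℚ (sumℤ (λ j → d j * X j i))       ≡⟨ sym (toℚ-+ (+ suc q * g i) _) ⟩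
      toℚ (+ suc q * g i + sumℤ (λ j → d j * X j i))               ∎
      where open ≡-Reasoning

  cone⇒inCone : (g h : Vℤ s) → Cone (λ i → h i - g i) → InCone X g (λ i → toℚ (h i))
  cone⇒inCone g h (q , d , e) with inverse q
  ... | ι , ι≥0 , inv = (λ j → ι ℚ.* toℚ (+ d j))
    , (λ j → subst (ℚ._≤ ι ℚ.* toℚ (+ d j)) (ℚ.*-zeroʳ ι)
               (ℚ.*-monoˡ-≤-nonNeg ι ⦃ ℚ.nonNegative ι≥0 ⦄ (toℚ-mono-≤ {0ℤ} {+ d j} (+≤+ z≤n))))
    , λ i → begin
      toℚ (h i)                                                      ≡⟨ cong toℚ (restore (h i) (g i)) ⟩
      toℚ (g i + (h i - g i))                                        ≡⟨ toℚ-+ (g i) (h i - g i) ⟩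
      toℚ (g i) ℚ.+ toℚ (h i - g i)
        ≡⟨ cong (ℚ._+_ (toℚ (g i))) (difference i) ⟩
      toℚ (g i) ℚ.+ sumℚ (λ j → ι ℚ.* toℚ (+ d j) ℚ.* toℚ (X j i))   ∎
    where
    open ≡-Reasoning
    restore : ∀ h g → h ≡ g + (h - g)
    restore = solve-∀
    difference : ∀ i → toℚ (h i - g i) ≡ sumℚ (λ j → ι ℚ.* toℚ (+ d j) ℚ.* toℚ (X j i))
    difference i = begin
      toℚ (h i - g i)                                    ≡⟨ sym (ℚ.*-identityˡ _) ⟩
      1ℚ ℚ.* toℚ (h i - g i)                             ≡⟨ cong (ℚ._* toℚ (h i - g i)) (sym inv) ⟩
      ι ℚ.* toℚ (+ suc q) ℚ.* toℚ (h i - g i)            ≡⟨ ℚ.*-assoc ι _ _ ⟩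
      ι ℚ.* (toℚ (+ suc q) ℚ.* toℚ (h i - g i))
        ≡⟨ cong (ℚ._*_ ι) (sym (toℚ-* (+ suc q) (h i - g i))) ⟩
      ι ℚ.* toℚ (+ suc q * (h i - g i))                  ≡⟨ cong (λ z → ι ℚ.* toℚ z) (sym (e i)) ⟩
      ι ℚ.* toℚ (comb d i)
        ≡⟨ cong (ℚ._*_ ι) (toℚ-sum (λ j → + d j * X j i)) ⟩
      ι ℚ.* sumℚ (λ j → toℚ (+ d j * X j i))             ≡⟨ sym (sumℚ-* ι (λ j → toℚ (+ d j * X j i))) ⟩
      sumℚ (λ j → ι ℚ.* toℚ (+ d j * X j i))
        ≡⟨ sumℚ-cong (λ j → trans (cong (ℚ._*_ ι) (toℚ-* (+ d j) (X j i))) (sym (ℚ.*-assoc ι (toℚ (+ d j)) (toℚ (X j i))))) ⟩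
      sumℚ (λ j → ι ℚ.* toℚ (+ d j) ℚ.* toℚ (X j i))     ∎

  -- Coefficients add, so containment of a whole translate need only be tested at its apex.
  inCone⇒subset : (g g′ : Vℤ s) → InCone X g′ (λ i → toℚ (g i)) → ConeSubset X g g′
  inCone⇒subset g g′ (μ , μ≥0 , e) y (ν , ν≥0 , f) = (λ j → μ j ℚ.+ ν j)
    , (λ j → subst (ℚ._≤ μ j ℚ.+ ν j) (ℚ.+-identityˡ 0ℚ) (ℚ.+-mono-≤ (μ≥0 j) (ν≥0 j)))
    , λ i → begin
      y i                                                             ≡⟨ f i ⟩
      toℚ (g i) ℚ.+ N i                                               ≡⟨ cong (ℚ._+ N i) (e i) ⟩
      toℚ (g′ i) ℚ.+ M i ℚ.+ N i
        ≡⟨ ℚ.+-assoc (toℚ (g′ i)) (M i) (N i) ⟩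
      toℚ (g′ i) ℚ.+ (M i ℚ.+ N i)                                    ≡⟨ cong (ℚ._+_ (toℚ (g′ i))) (trans
          (sym (sumℚ-+ (λ j → μ j ℚ.* toℚ (X j i)) (λ j → ν j ℚ.* toℚ (X j i))))
          (sumℚ-cong (λ j → sym (ℚ.*-distribʳ-+ (toℚ (X j i)) (μ j) (ν j))))) ⟩
      toℚ (g′ i) ℚ.+ sumℚ (λ j → (μ j ℚ.+ ν j) ℚ.* toℚ (X j i))       ∎
    where
    open ≡-Reasoning
    M N : Fin _ → ℚ
    M i = sumℚ (λ j → μ j ℚ.* toℚ (X j i))
    N i = sumℚ (λ j → ν j ℚ.* toℚ (X j i))

  saturated⇒saturatedInJ : ∀ g → Saturated X g → SaturatedInJ g
  saturated⇒saturatedInJ g sat h inL cone = sat h inL (cone⇒inCone g h cone)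

  saturatedInJ⇒saturated : ∀ g → SaturatedInJ g → Saturated X g
  saturatedInJ⇒saturated g sat h inL cone = sat h inL (inCone⇒cone g h cone)

  -- Scaling by a positive common denominator preserves the signs, and later comparisons of weights
  -- then take place in the integers.
  integral-functional : PositiveFunctional X → ∃ λ (a : Fin s → ℤ) → ∀ j → 0ℤ ℤ.< sumℤ (λ i → X j i * a i)
  integral-functional (α , pos) with clear-denominators α
  ... | q , a , clear = a , λ j → toℚ-cancel-< (subst₂ ℚ._<_ (ℚ.*-zeroʳ Q) (scaled j)
        (ℚ.*-monoʳ-<-pos Q ⦃ ℚ.normalize-pos (suc q) 1 ⦄ (pos j)))
    where
    Q = toℚ (+ suc q)
    scaled : ∀ j → Q ℚ.* sumℚ (λ i → toℚ (X j i) ℚ.* α i) ≡ toℚ (sumℤ (λ i → X j i * a i))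
    scaled j = trans (sym (sumℚ-* Q (λ i → toℚ (X j i) ℚ.* α i))) (trans (sumℚ-cong (λ i → begin
      Q ℚ.* (toℚ (X j i) ℚ.* α i)   ≡⟨ sym (ℚ.*-assoc Q (toℚ (X j i)) (α i)) ⟩
      Q ℚ.* toℚ (X j i) ℚ.* α i     ≡⟨ cong (ℚ._* α i) (ℚ.*-comm Q (toℚ (X j i))) ⟩
      toℚ (X j i) ℚ.* Q ℚ.* α i     ≡⟨ ℚ.*-assoc (toℚ (X j i)) Q (α i) ⟩
      toℚ (X j i) ℚ.* (Q ℚ.* α i)   ≡⟨ cong (ℚ._*_ (toℚ (X j i))) (clear i) ⟩
      toℚ (X j i) ℚ.* toℚ (a i)     ≡⟨ sym (toℚ-* (X j i) (a i)) ⟩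
      toℚ (X j i * a i)             ∎)) (sym (toℚ-sum (λ i → X j i * a i))))
      where open ≡-Reasoning

-- Generators and maximal saturated cones.

module Frobenius (X : Fin m → Vℤ s) (upset : FinitelyGeneratedUpSet (Lattice.SaturatedCoefficients X))
  (a : Fin s → ℤ) (positive : ∀ j → 0ℤ ℤ.< sumℤ (λ i → X j i * a i)) where
  open Lattice X
  open RationalCone X
  open FinitelyGeneratedUpSet upset

  weight : Fin m → ℤ
  weight j = sumℤ (λ i → X j i * a i)

  ⟨_⟩ : Vℤ s → ℤ
  ⟨ v ⟩ = sumℤ (λ i → v i * a i)

  ⟨⟩-difference : ∀ g h → ⟨ (λ i → g i - h i) ⟩ ≡ ⟨ g ⟩ - ⟨ h ⟩
  ⟨⟩-difference g h = trans (sumℤ-cong (λ i → distrib (g i) (h i) (a i)))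
    (trans (sumℤ-+ (λ i → g i * a i) (λ i → - (h i * a i))) (cong (_+_ ⟨ g ⟩) (sumℤ-neg (λ i → h i * a i))))
    where
    distrib : ∀ g h a → (g - h) * a ≡ g * a + - (h * a)
    distrib = solve-∀

  term-nonneg : (d : Fin m → ℕ) → ∀ j → 0ℤ ℤ.≤ + d j * weight j
  term-nonneg d j = subst (ℤ._≤ + d j * weight j) (ℤ.*-zeroʳ (+ d j)) (ℤ.*-monoˡ-≤-nonNeg (+ d j) (ℤ.<⇒≤ (positive j)))

  cone-weight : ∀ {v} q d → (∀ i → comb d i ≡ + suc q * v i) → d · weight ≡ + suc q * ⟨ v ⟩
  cone-weight {v} q d e = trans (sym (·-assoc d X a)) (trans
    (sumℤ-cong (λ i → trans (cong (_* a i) (e i)) (ℤ.*-assoc (+ suc q) (v i) (a i)))) (sumℤ-* (+ suc q) (λ i → v i * a i)))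

  cone⇒nonneg : ∀ {v} → Cone v → 0ℤ ℤ.≤ ⟨ v ⟩
  cone⇒nonneg {v} (q , d , e) = ℤ.*-cancelˡ-≤-pos 0ℤ ⟨ v ⟩ (+ suc q)
    (subst₂ ℤ._≤_ (sym (ℤ.*-zeroʳ (+ suc q))) (cone-weight q d e) (sumℤ-nonneg (term-nonneg d)))

  -- Every `X j` has positive weight, so a natural combination of total weight at most 0 has only
  -- zero coefficients.
  pointed : ∀ {v} → Cone v → ⟨ v ⟩ ℤ.≤ 0ℤ → ∀ i → v i ≡ 0ℤ
  pointed {v} (q , d , e) v≤0 i with ℤ.i*j≡0⇒i≡0∨j≡0 (+ suc q)
      (trans (sym (e i)) (sumℤ-zero (λ j → cong (λ z → + z * X j i) (d≡0 j))))
    where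
    total≤0 : d · weight ℤ.≤ 0ℤ
    total≤0 = subst₂ ℤ._≤_ (sym (cone-weight q d e)) (ℤ.*-zeroʳ (+ suc q)) (ℤ.*-monoˡ-≤-nonNeg (+ suc q) v≤0)
    d≡0 : ∀ j → d j ≡ 0
    d≡0 j with ℤ.i*j≡0⇒i≡0∨j≡0 (+ d j) (ℤ.≤-antisym (ℤ.≤-trans (term≤sumℤ (term-nonneg d) j) total≤0) (term-nonneg d j))
    ... | inj₁ dj≡0 = ℤ.+-injective dj≡0
    ... | inj₂ wj≡0 = contradiction (positive j) (ℤ.<-irrefl (sym wj≡0))
  ... | inj₁ ()
  ... | inj₂ vi≡0 = vi≡0

  -- The comparison of weights stands in for the reverse cone condition, from which it follows by
  -- `cone⇒≤`.
  antisymmetric : ∀ g h → Cone (λ i → g i - h i) → ⟨ g ⟩ ℤ.≤ ⟨ h ⟩ → g ≗ h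
  antisymmetric g h cone le i = ℤ.i-j≡0⇒i≡j (g i) (h i)
    (pointed cone (subst (ℤ._≤ 0ℤ) (sym (⟨⟩-difference g h)) (ℤ.i≤j⇒i-j≤0 le)) i)

  cone⇒≤ : ∀ g h → Cone (λ i → g i - h i) → ⟨ h ⟩ ℤ.≤ ⟨ g ⟩
  cone⇒≤ g h cone = ℤ.0≤i-j⇒j≤i (subst (0ℤ ℤ.≤_) (⟨⟩-difference g h) (cone⇒nonneg cone))

  cone-≗ : ∀ g h → g ≗ h → Cone (λ i → g i - h i)
  cone-≗ g h e = 0 , (λ _ → 0) , λ i → trans (sumℤ-zero (λ j → ℤ.*-zeroˡ (X j i)))
    (sym (trans (ℤ.*-identityˡ (g i - h i)) (ℤ.i≡j⇒i-j≡0 (e i))))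

  apex : ∀ g → InCone X g (λ i → toℚ (g i))
  apex g = cone⇒inCone g g (cone-≗ g g (λ _ → refl))

  cone-≤ᵛ : ∀ {g c k} → g ≗ comb c → k ≤ᵛ c → Cone (λ i → g i - comb k i)
  cone-≤ᵛ {g} {c} {k} e le = 0 , (λ j → c j ℕ.∸ k j) , λ i → trans (isolate (comb k i) (comb (λ j → c j ℕ.∸ k j) i) (g i)
      (trans (sym (·-+ k (λ j → c j ℕ.∸ k j) (λ j → X j i)))
        (trans (·-congˡ {a = λ j → X j i} (λ j → ℕ.m+[n∸m]≡n (le j))) (sym (e i)))))
      (sym (ℤ.*-identityˡ _))
    where
    isolate : ∀ a b c → a + b ≡ c → b ≡ c - a
    isolate a b _ refl = ring a b
      where
      ring : ∀ a b → b ≡ a + b - a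
      ring = solve-∀

  coefficients⇒saturatedComb : ∀ c → SaturatedCoefficients c → Saturated X (comb c)
  coefficients⇒saturatedComb c h = saturatedInJ⇒saturated (comb c) (coefficients⇒saturated c (λ _ → refl) h)

  -- Every saturated cone with apex in the semigroup thus lies inside one of finitely many saturated
  -- cones; finiteness and non-emptiness both rest on this.
  generator-below : ∀ g → InJ X g → Saturated X g → ∃ λ k → k ∈ generators × Cone (λ i → g i - comb k i)
  generator-below g (c , e) sat =
    let k , k∈ , k≤ = complete c (saturated⇒coefficients c e (saturated⇒saturatedInJ g sat))
    in k , k∈ , cone-≤ᵛ e k≤

  finite : FiniteSet (InFrobenius X)
  finite = map comb generators , covered
    where
    covered : ∀ g → InFrobenius X g → ∃ λ g′ → g′ ∈ map comb generators × (∀ i → g i ≡ g′ i)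
    covered g (inJ , sat , maximal) = comb k , ∈-map⁺ comb k∈ , g≗k
      where
      below = generator-below g inJ sat
      k = proj₁ below
      k∈ = proj₁ (proj₂ below)
      cone = proj₂ (proj₂ below)
      -- If the cones agreed, each apex would lie in the other cone, and pointedness would make the
      -- apexes equal.
      differ : ¬ (g ≗ comb k) → ConeDiffer X g (comb k)
      differ ne same = ne (antisymmetric g (comb k) cone (cone⇒≤ (comb k) g
        (inCone⇒cone g (comb k) (proj₂ (same (λ i → toℚ (comb k i))) (apex (comb k))))))
      -- Maximality only refutes `ConeDiffer`, so equality comes doubly negated; it is decidable for
      -- integer vectors and hence stable.
      g≗k : g ≗ comb k
      g≗k = decidable-stable (Fin.all? (λ i → g i ℤ.≟ comb k i)) λ ne →
        maximal (comb k) (k , λ _ → refl) (coefficients⇒saturatedComb k (sound k∈))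
          (inCone⇒subset g (comb k) (cone⇒inCone (comb k) g cone)) (differ ne)

  nonempty : ∃ (InFrobenius X)
  nonempty = comb k , (k , λ _ → refl) , coefficients⇒saturatedComb k (sound k∈) , maximal
    where
    start = complete (proj₁ inhabited) (proj₂ inhabited)
    size : (Fin m → ℕ) → ℤ
    size c = ⟨ comb c ⟩
    -- The default value is itself a generator, obtained from an inhabitant of the up-set, so the
    -- minimum is attained in `generators`.
    k = argmin size (proj₁ start) generators
    k∈ : k ∈ generators
    k∈ = [ (λ eq → subst (_∈ generators) (sym eq) (proj₁ (proj₂ start))) , (λ h → h) ]′
           (argmin-sel size (proj₁ start) generators)
    maximal : ∀ g → InJ X g → Saturated X g → ConeSubset X (comb k) g → ¬ ConeDiffer X (comb k) g
    maximal g inJ sat sub differ = differ (λ y → sub y , inCone⇒subset g (comb k)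
        (cone⇒inCone (comb k) g (cone-≗ g (comb k) (λ i → sym (k≗g i)))) y)
      where
      below = generator-below g inJ sat
      l = proj₁ below
      k≤l : size k ℤ.≤ size l
      k≤l = All.lookup (f[argmin]≤f[xs] {f = size} (proj₁ start) generators) (proj₁ (proj₂ below))
      -- The weight of `comb k` is at most that of `comb l`, hence at most that of `g`, while
      -- `comb k` lies in the cone at `g`; pointedness forces equality.
      k≗g : comb k ≗ g
      k≗g = antisymmetric (comb k) g
        (inCone⇒cone g (comb k) (sub (λ i → toℚ (comb k i)) (apex (comb k))))
        (ℤ.≤-trans k≤l (cone⇒≤ g (comb l) (proj₂ (proj₂ below))))

theorem1p1 : (m s : ℕ) → 2 ≤ m → 1 ≤ s → (X : Fin m → Vℤ s) →
    Spans X → PositiveFunctional X →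
    (∃ λ (g : Vℤ s) → InFrobenius X g) × FiniteSet (InFrobenius X)
theorem1p1 m s _ _ X _ functional = nonempty , finite
  where
  integral = RationalCone.integral-functional X functional
  open Frobenius X (Lattice.saturatedOn-upset X (Lattice.box X)) (proj₁ integral) (proj₂ integral)
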